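{- For any connected graph $G$ with no isolated vertex and of minimum degree $\delta$, $$\gamma_{oitR}(G)\leq 2\alpha(G)+\gamma(G)-\delta+1.$$
   Context: All graphs are finite, undirected and simple (no loops or multiple edges). $\alpha(G)$ is the vertex cover number: the minimum cardinality of a set of vertices such that every edge of $G$ is incident to at least one vertex of the set. $\gamma(G)$ is the domination number: the minimum cardinality of a set $D\subseteq V(G)$ such that every vertex in $V(G)\setminus D$ has a neighbor in $D$. For a graph $G$ with no isolated vertex and a function $f:V(G)\to\{0,1,2\}$, let $V_i=\{v\in V(G): f(v)=i\}$ for $i\in\{0,1,2\}$. The function $f$ is an outer-independent total Roman dominating function on $G$ if (i) every vertex in $V_0$ is adjacent to at least one vertex in $V_2$; (ii) $V_0$ is an independent set; and (iii) the subgraph induced by $V_1\cup V_2$ has no isolated vertex. The outer-independent total Roman domination number $\gamma_{oitR}(G)$ is the minimum weight $\omega(f)=\sum_{v\in V(G)}f(v)$ among all such functions. -}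

module Defs where

open import Data.Bool.Base using (Bool; true; false)
open import Data.Fin.Base using (Fin; zero; suc; toℕ)
open import Data.Fin.Patterns using (0F; 1F; 2F)
open import Data.Fin.Properties using (all?; any?; _≟_)
open import Data.Fin.Subset using (Subset; _∈_; _∉_; ∣_∣; ⊤)
open import Data.Fin.Subset.Properties using (_∈?_; ∈⊤)
open import Data.List.Base using (List; []; _∷_; filter; allFin; cartesianProductWith)
open import Data.List.Extrema using (argmin; argmin-all; f[argmin]≤f[xs])
import Data.List.Membership.Propositional as List
open import Data.List.Membership.Propositional.Properties
  using (∈-filter⁺; ∈-allFin; ∈-cartesianProductWith⁺)
import Data.List.Relation.Unary.All as All
open import Data.List.Relation.Unary.All.Properties using (all-filter)
open import Data.List.Relation.Unary.Any using (here; there)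
open import Data.Nat.Base using (ℕ; zero; suc; _≤_)
open import Data.Nat.Properties using (≤-totalOrder)
open import Data.Product.Base using (∃; _×_; _,_; proj₁; proj₂)
open import Data.Sum.Base using (_⊎_; inj₁)
open import Data.Vec.Base using (Vec; []; _∷_; lookup; map; replicate; sum; tabulate)
open import Data.Vec.Properties using (lookup-replicate)
open import Level using (0ℓ)
open import Relation.Binary.Construct.Closure.ReflexiveTransitive using (Star)
open import Relation.Binary.Core using (Rel)
open import Relation.Binary.Definitions using (Symmetric; Irreflexive)
  renaming (Decidable to Decidable₂)
open import Relation.Binary.PropositionalEquality
  using (_≡_; refl; sym; trans)
open import Relation.Nullary.Decidable
  using (Dec; does; map′; ¬?; _×-dec_; _⊎-dec_; _→-dec_)
open import Relation.Nullary.Negation using (¬_; contradiction)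
open import Relation.Unary using (Pred; Decidable; U; _∪_)
  renaming (_∈_ to _∈ₚ_)
open import Relation.Unary.Properties using (U?; _∪?_)

------------------------------------------------------------------------
-- Minima over finite types

record IsMinimum {A : Set} (P : Pred A 0ℓ) (w : A → ℕ) (k : ℕ) : Set where
  field
    attained : ∃ λ x → P x × w x ≡ k
    least    : ∀ {x} → P x → k ≤ w x

record Finite (A : Set) : Set where
  field
    elements : List A
    complete : ∀ x → x List.∈ elements

-- P must be inhabited for the minimum to exist, whence the argument P x₀.
minimum : ∀ {A : Set} → Finite A → {P : Pred A 0ℓ} → Decidable P →
          (w : A → ℕ) → ∃ P → ∃ (IsMinimum P w)
minimum {A} fin {P} P? w (x₀ , Px₀) = w best , record
  { attained = best , argmin-all ≤-totalOrder w Px₀ (all-filter P? elements) , refl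
  ; least    = λ {x} Px → All.lookup (f[argmin]≤f[xs] ≤-totalOrder {f = w} x₀ candidates)
                                     (∈-filter⁺ P? (complete x) Px)
  }
  where
  open Finite fin
  candidates : List A
  candidates = filter P? elements
  best : A
  best = argmin ≤-totalOrder w x₀ candidates

finite-Bool : Finite Bool
finite-Bool = record
  { elements = true ∷ false ∷ []
  ; complete = λ { true → here refl ; false → there (here refl) }
  }

finite-Fin : ∀ n → Finite (Fin n)
finite-Fin n = record { elements = allFin n ; complete = ∈-allFin }

finite-Vec : ∀ {A : Set} → Finite A → ∀ n → Finite (Vec A n)
finite-Vec fin zero = record
  { elements = [] ∷ []
  ; complete = λ { [] → here refl }
  }
finite-Vec fin (suc n) = record
  { elements = cartesianProductWith _∷_ (elements fin) (elements (finite-Vec fin n))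
  ; complete = λ { (x ∷ xs) → ∈-cartesianProductWith⁺ _∷_ (complete fin x)
                                (complete (finite-Vec fin n) xs) }
  }
  where open Finite

------------------------------------------------------------------------
-- Finite simple graphs

record Graph (n : ℕ) : Set₁ where
  infix 4 _~_ _~?_
  field
    _~_      : Rel (Fin n) 0ℓ
    ~-sym    : Symmetric _~_
    ~-irrefl : Irreflexive _≡_ _~_
    _~?_     : Decidable₂ _~_

Labelling : ℕ → Set
Labelling n = Vec (Fin 3) n

weight : ∀ {n} → Labelling n → ℕ
weight f = sum (map toℕ f)

V : ∀ {n} → Labelling n → Fin 3 → Pred (Fin n) 0ℓ
V f i v = lookup f v ≡ i

module _ {n : ℕ} (G : Graph n) where
  open Graph G

  Connected : Set
  Connected = ∀ u v → Star _~_ u v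

  -- The subgraph induced by S has no isolated vertex.
  NoIsolatedVertexIn : Pred (Fin n) 0ℓ → Set
  NoIsolatedVertexIn S = ∀ v → v ∈ₚ S → ∃ λ u → u ∈ₚ S × v ~ u

  NoIsolatedVertex : Set
  NoIsolatedVertex = NoIsolatedVertexIn U

  Independent : Pred (Fin n) 0ℓ → Set
  Independent S = ∀ u v → u ∈ₚ S → v ∈ₚ S → ¬ u ~ v

  neighbourhood : Fin n → Subset n
  neighbourhood v = tabulate (λ u → does (v ~? u))

  degree : Fin n → ℕ
  degree v = ∣ neighbourhood v ∣

  VertexCover : Pred (Subset n) 0ℓ
  VertexCover S = ∀ u v → u ~ v → u ∈ S ⊎ v ∈ S

  Dominating : Pred (Subset n) 0ℓ
  Dominating D = ∀ v → v ∉ D → ∃ λ u → u ∈ D × v ~ u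

  record OITRDominating (f : Labelling n) : Set where
    field
      roman             : ∀ v → v ∈ₚ V f 0F → ∃ λ u → u ∈ₚ V f 2F × v ~ u
      outer-independent : Independent (V f 0F)
      total             : NoIsolatedVertexIn (V f 1F ∪ V f 2F)

  noIsolatedVertexIn? : ∀ {S : Pred (Fin n) 0ℓ} → Decidable S → Dec (NoIsolatedVertexIn S)
  noIsolatedVertexIn? S? =
    all? λ v → S? v →-dec any? λ u → S? u ×-dec v ~? u

  vertexCover? : Decidable VertexCover
  vertexCover? S =
    all? λ u → all? λ v → u ~? v →-dec (u ∈? S ⊎-dec v ∈? S)

  dominating? : Decidable Dominating
  dominating? D =
    all? λ v → ¬? (v ∈? D) →-dec any? λ u → u ∈? D ×-dec v ~? u

  V? : ∀ (f : Labelling n) i → Decidable (V f i)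
  V? f i v = lookup f v ≟ i

  oitrDominating? : Decidable OITRDominating
  oitrDominating? f = map′
    (λ (r , o , t) → record { roman = r ; outer-independent = o ; total = t })
    (λ d → let open OITRDominating d in roman , outer-independent , total)
    ( (all? λ v → V? f 0F v →-dec any? λ u → V? f 2F u ×-dec v ~? u)
    ×-dec (all? λ u → all? λ v → V? f 0F u →-dec (V? f 0F v →-dec ¬? (u ~? v)))
    ×-dec noIsolatedVertexIn? (V? f 1F ∪? V? f 2F) )

  allOnes-OITRDominating : NoIsolatedVertex → OITRDominating (replicate n 1F)
  allOnes-OITRDominating noIso = record
    { roman             = λ v v∈V₀ → contradiction v∈V₀ (∉V₀ v)
    ; outer-independent = λ u _ u∈V₀ → contradiction u∈V₀ (∉V₀ u)
    ; total             = λ v _ → let (u , _ , v~u) = noIso v _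
                                  in u , inj₁ (lookup-replicate u 1F) , v~u
    }
    where
    ∉V₀ : ∀ v → ¬ (v ∈ₚ V (replicate n 1F) 0F)
    ∉V₀ v eq with () ← trans (sym (lookup-replicate v 1F)) eq

  vertexCover-minimum : ∃ (IsMinimum VertexCover ∣_∣)
  vertexCover-minimum =
    minimum (finite-Vec finite-Bool n) vertexCover? ∣_∣ (⊤ , λ _ _ _ → inj₁ ∈⊤)

  domination-minimum : ∃ (IsMinimum Dominating ∣_∣)
  domination-minimum =
    minimum (finite-Vec finite-Bool n) dominating? ∣_∣
            (⊤ , λ _ v∉⊤ → contradiction ∈⊤ v∉⊤)

  oitrDomination-minimum : NoIsolatedVertex → ∃ (IsMinimum OITRDominating weight)
  oitrDomination-minimum noIso =
    minimum (finite-Vec (finite-Fin 3) n) oitrDominating? weight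
            (replicate n 1F , allOnes-OITRDominating noIso)

  -- The vertex cover number; note that α here is not the independence number.
  α : ℕ
  α = proj₁ vertexCover-minimum

  γ : ℕ
  γ = proj₁ domination-minimum

  γoitR : NoIsolatedVertex → ℕ
  γoitR noIso = proj₁ (oitrDomination-minimum noIso)

-- A minimum degree needs at least one vertex.
minDegree-minimum : ∀ {n} (G : Graph (suc n)) → ∃ (IsMinimum U (degree G))
minDegree-minimum {n} G = minimum (finite-Fin (suc n)) U? (degree G) (zero , _)

δ : ∀ {n} → Graph (suc n) → ℕ
δ G = proj₁ (minDegree-minimum G)

-- Let S be a minimum vertex cover and D a minimum dominating set. Let E consist of the vertices
-- of D outside S and of one neighbour of each vertex of D inside S: then |E| ≤ |D|, and every
-- vertex of S has a neighbour in S ∪ E. Let A ⊆ S be any subset with |S| + 1 - δ elements. All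
-- neighbours of a vertex outside S lie in S, and there are at least δ of them, so at least one
-- is in A. Hence A = V₂ and S ∪ E = V₁ ∪ V₂ define an outer-independent total Roman dominating
-- function of weight |A| + |S ∪ E| ≤ (|S| + 1 - δ) + (|S| + |D|).

module Submission where

open import Defs
open import Data.Bool.Base using (if_then_else_)
open import Data.Fin.Base using (Fin; zero; suc)
open import Data.Fin.Patterns using (0F; 1F; 2F)
open import Data.Fin.Properties using (any?)
open import Data.Fin.Subset
  using (Subset; Side; inside; outside; _∈_; _∉_; _⊆_; ∣_∣; ⊥; ⁅_⁆; _∪_; _∩_; Nonempty)
open import Data.Fin.Subset.Properties
  using (_∈?_; x∈p∪q⁺; x∈p∪q⁻; x∈p∩q⁻; p⊆q⇒∣p∣≤∣q∣; ∣⊥∣≡0; ∣⁅x⁆∣≡1; x∈⁅x⁆; x∈⁅y⁆⇒x≡y;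
         nonempty?; Empty-unique; ∉⊥; out⊆; in⊆in)
open import Data.Integer.Base using (+_; _+_; _-_; _*_; _≤_; _⊖_; +≤+)
import Data.Integer.Properties as ℤ
open import Data.Integer.Tactic.RingSolver using (solve-∀)
open import Data.Nat.Base as ℕ using (suc; s≤s; _∸_)
import Data.Nat.Properties as ℕ
open import Data.Product.Base using (∃; _×_; _,_; proj₁; proj₂)
open import Data.Sum.Base as Sum using (inj₁; inj₂; [_,_]′)
open import Data.Vec.Base using ([]; _∷_; here; there; lookup; zipWith)
open import Data.Vec.Properties
  using ([]=⇒lookup; lookup⇒[]=; lookup-zipWith; lookup∘tabulate)
open import Function.Base using (_∘_; id)
open import Relation.Binary.PropositionalEquality
  using (_≡_; refl; sym; trans; cong; cong₂; subst)
open import Relation.Nullary.Decidable using (yes; no; does; dec-true; decidable-stable; ¬?)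
open import Relation.Nullary.Negation using (contradiction)
import Relation.Unary as Unary

-- Cardinalities of subsets and images.

∣p∪q∣+∣p∩q∣≡∣p∣+∣q∣ : ∀ {n} (p q : Subset n) → ∣ p ∪ q ∣ ℕ.+ ∣ p ∩ q ∣ ≡ ∣ p ∣ ℕ.+ ∣ q ∣
∣p∪q∣+∣p∩q∣≡∣p∣+∣q∣ []            []            = refl
∣p∪q∣+∣p∩q∣≡∣p∣+∣q∣ (outside ∷ p) (outside ∷ q) = ∣p∪q∣+∣p∩q∣≡∣p∣+∣q∣ p q
∣p∪q∣+∣p∩q∣≡∣p∣+∣q∣ (inside  ∷ p) (outside ∷ q) = cong suc (∣p∪q∣+∣p∩q∣≡∣p∣+∣q∣ p q)
∣p∪q∣+∣p∩q∣≡∣p∣+∣q∣ (outside ∷ p) (inside  ∷ q) =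
  trans (cong suc (∣p∪q∣+∣p∩q∣≡∣p∣+∣q∣ p q)) (sym (ℕ.+-suc ∣ p ∣ ∣ q ∣))
∣p∪q∣+∣p∩q∣≡∣p∣+∣q∣ (inside  ∷ p) (inside  ∷ q) = cong suc
  (trans (ℕ.+-suc _ _) (trans (cong suc (∣p∪q∣+∣p∩q∣≡∣p∣+∣q∣ p q)) (sym (ℕ.+-suc _ _))))

∣p∪q∣≤∣p∣+∣q∣ : ∀ {n} (p q : Subset n) → ∣ p ∪ q ∣ ℕ.≤ ∣ p ∣ ℕ.+ ∣ q ∣
∣p∪q∣≤∣p∣+∣q∣ p q = ℕ.≤-trans (ℕ.m≤m+n _ _) (ℕ.≤-reflexive (∣p∪q∣+∣p∩q∣≡∣p∣+∣q∣ p q))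

-- Pigeonhole inside `r`: if `p` and `q` were disjoint, their sizes would add up to that of `p ∪ q`,
-- which is at most `∣ r ∣`.
∣r∣<∣p∣+∣q∣⇒p∩q≢∅ : ∀ {n} {p q r : Subset n} → p ⊆ r → q ⊆ r →
                    ∣ r ∣ ℕ.< ∣ p ∣ ℕ.+ ∣ q ∣ → Nonempty (p ∩ q)
∣r∣<∣p∣+∣q∣⇒p∩q≢∅ {n} {p} {q} {r} p⊆r q⊆r r<p+q with nonempty? (p ∩ q)
... | yes ne = ne
... | no  empty = contradiction r<p+q (ℕ.≤⇒≯ (begin
  ∣ p ∣ ℕ.+ ∣ q ∣          ≡⟨ ∣p∪q∣+∣p∩q∣≡∣p∣+∣q∣ p q ⟨
  ∣ p ∪ q ∣ ℕ.+ ∣ p ∩ q ∣  ≡⟨ cong (λ s → ∣ p ∪ q ∣ ℕ.+ ∣ s ∣) (Empty-unique empty) ⟩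
  ∣ p ∪ q ∣ ℕ.+ ∣ ⊥ {n} ∣  ≡⟨ cong (∣ p ∪ q ∣ ℕ.+_) (∣⊥∣≡0 n) ⟩
  ∣ p ∪ q ∣ ℕ.+ 0          ≡⟨ ℕ.+-identityʳ _ ⟩
  ∣ p ∪ q ∣                ≤⟨ p⊆q⇒∣p∣≤∣q∣ ([ p⊆r , q⊆r ]′ ∘ x∈p∪q⁻ p q) ⟩
  ∣ r ∣                    ∎))
  where open ℕ.≤-Reasoning

subset-of-size : ∀ {n} (p : Subset n) k → k ℕ.≤ ∣ p ∣ → ∃ λ q → q ⊆ p × ∣ q ∣ ≡ k
subset-of-size {n} p             ℕ.zero  _ = ⊥ , (λ x∈⊥ → contradiction x∈⊥ ∉⊥) , ∣⊥∣≡0 n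
subset-of-size     (outside ∷ p) (suc k) k≤p =
  let (q , q⊆p , q≡k) = subset-of-size p (suc k) k≤p
  in outside ∷ q , out⊆ q⊆p , q≡k
subset-of-size     (inside  ∷ p) (suc k) (s≤s k≤p) =
  let (q , q⊆p , q≡k) = subset-of-size p k k≤p
  in inside ∷ q , in⊆in q⊆p , cong suc q≡k

image : ∀ {m n} → (Fin m → Fin n) → Subset m → Subset n
image g []            = ⊥
image g (outside ∷ p) = image (g ∘ suc) p
image g (inside  ∷ p) = ⁅ g zero ⁆ ∪ image (g ∘ suc) p

∈-image⁺ : ∀ {m n} (g : Fin m → Fin n) {p x} → x ∈ p → g x ∈ image g p
∈-image⁺ g {inside  ∷ p} here        = x∈p∪q⁺ (inj₁ (x∈⁅x⁆ (g zero)))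
∈-image⁺ g {inside  ∷ p} (there x∈p) = x∈p∪q⁺ (inj₂ (∈-image⁺ (g ∘ suc) x∈p))
∈-image⁺ g {outside ∷ p} (there x∈p) = ∈-image⁺ (g ∘ suc) x∈p

-- The image is a union of `∣ p ∣` singletons, and collisions under `g` only make it smaller.
∣image∣≤ : ∀ {m n} (g : Fin m → Fin n) p → ∣ image g p ∣ ℕ.≤ ∣ p ∣
∣image∣≤ {n = n} g []            = ℕ.≤-reflexive (∣⊥∣≡0 n)
∣image∣≤         g (outside ∷ p) = ∣image∣≤ (g ∘ suc) p
∣image∣≤         g (inside  ∷ p) = ℕ.≤-trans (∣p∪q∣≤∣p∣+∣q∣ ⁅ g zero ⁆ _)
  (ℕ.+-mono-≤ (ℕ.≤-reflexive (∣⁅x⁆∣≡1 (g zero))) (∣image∣≤ (g ∘ suc) p))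

-- Labellings built from two subsets.

label : Side → Side → Fin 3
label inside  inside  = 2F
label inside  outside = 1F
label outside inside  = 1F
label outside outside = 0F

-- The sum of the indicator functions of A and B; for A ⊆ B, its V₂ is A and its V₁ ∪ V₂ is B.
labelling : ∀ {n} → Subset n → Subset n → Labelling n
labelling = zipWith label

weight-labelling : ∀ {n} (A B : Subset n) → weight (labelling A B) ≡ ∣ A ∣ ℕ.+ ∣ B ∣
weight-labelling []            []            = refl
weight-labelling (inside  ∷ A) (inside  ∷ B) =
  cong suc (trans (cong suc (weight-labelling A B)) (sym (ℕ.+-suc ∣ A ∣ ∣ B ∣)))
weight-labelling (inside  ∷ A) (outside ∷ B) = cong suc (weight-labelling A B)
weight-labelling (outside ∷ A) (inside  ∷ B) =
  trans (cong suc (weight-labelling A B)) (sym (ℕ.+-suc ∣ A ∣ ∣ B ∣))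
weight-labelling (outside ∷ A) (outside ∷ B) = weight-labelling A B

module _ {n} (A B : Subset n) where

  private
    lookup-labelling : ∀ v → lookup (labelling A B) v ≡ label (lookup A v) (lookup B v)
    lookup-labelling v = lookup-zipWith label v A B

  V₂⁺ : A ⊆ B → ∀ {v} → v ∈ A → V (labelling A B) 2F v
  V₂⁺ A⊆B {v} v∈A = trans (lookup-labelling v)
    (cong₂ label ([]=⇒lookup v∈A) ([]=⇒lookup (A⊆B v∈A)))

  V₁∪V₂⁺ : ∀ {v} → v ∈ B → (V (labelling A B) 1F Unary.∪ V (labelling A B) 2F) v
  V₁∪V₂⁺ {v} v∈B
    rewrite lookup-labelling v | []=⇒lookup v∈B with lookup A v
  ... | inside  = inj₂ refl
  ... | outside = inj₁ refl

  V₀⁻ : ∀ {v} → V (labelling A B) 0F v → v ∉ B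
  V₀⁻ v∈V₀ v∈B with V₁∪V₂⁺ v∈B
  ... | inj₁ v∈V₁ with () ← trans (sym v∈V₀) v∈V₁
  ... | inj₂ v∈V₂ with () ← trans (sym v∈V₀) v∈V₂

  V₁∪V₂⁻ : A ⊆ B → ∀ {v} → (V (labelling A B) 1F Unary.∪ V (labelling A B) 2F) v → v ∈ B
  V₁∪V₂⁻ A⊆B {v} v∈V₁∪V₂
    rewrite lookup-labelling v with lookup A v in A[v] | lookup B v in B[v]
  ... | inside  | _       = A⊆B (lookup⇒[]= v A A[v])
  ... | outside | inside  = lookup⇒[]= v B B[v]
  ... | outside | outside = contradiction v∈V₁∪V₂ [ (λ ()) , (λ ()) ]′

-- Neighbourhoods, vertex covers and total extensions.

module _ {n} (G : Graph n) where
  open Graph G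

  ∈-neighbourhood⁺ : ∀ {u v} → v ~ u → u ∈ neighbourhood G v
  ∈-neighbourhood⁺ {u} {v} v~u = lookup⇒[]= u _
    (trans (lookup∘tabulate _ u) (dec-true (v ~? u) v~u))

  ∈-neighbourhood⁻ : ∀ {u v} → u ∈ neighbourhood G v → v ~ u
  ∈-neighbourhood⁻ {u} {v} u∈N
    with v ~? u | trans (sym (lookup∘tabulate (λ w → does (v ~? w)) u)) ([]=⇒lookup u∈N)
  ... | yes v~u | _ = v~u

  -- An edge at a vertex outside `S` can only be covered at its other end.
  neighbourhood⊆cover : ∀ {S v} → VertexCover G S → v ∉ S → neighbourhood G v ⊆ S
  neighbourhood⊆cover {v = v} cover v∉S {u} u∈N =
    [ (λ v∈S → contradiction v∈S v∉S) , id ]′ (cover v u (∈-neighbourhood⁻ u∈N))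

  -- This makes `suc ∣ S ∣ ∸ degree G v` at most `∣ S ∣`, so that a set `A` of that size fits inside
  -- `S`.
  degree>0 : NoIsolatedVertex G → ∀ v → 1 ℕ.≤ degree G v
  degree>0 noIso v = let (u , _ , v~u) = noIso v _ in
    ℕ.≤-trans (ℕ.≤-reflexive (sym (∣⁅x⁆∣≡1 u)))
      (p⊆q⇒∣p∣≤∣q∣ λ x∈⁅u⁆ → subst (_∈ neighbourhood G v) (sym (x∈⁅y⁆⇒x≡y u x∈⁅u⁆))
                                 (∈-neighbourhood⁺ v~u))

  -- The vertices labelled 0 form the complement of `B`. An edge between two of them would escape
  -- the cover `B`, and each of them needs its neighbour of label 2 in `A`.
  labelling-OITRDominating : ∀ {A B} → A ⊆ B → VertexCover G B →
    (∀ v → v ∉ B → ∃ λ u → u ∈ A × v ~ u) → NoIsolatedVertexIn G (_∈ B) →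
    OITRDominating G (labelling A B)
  labelling-OITRDominating {A} {B} A⊆B cover dom tot = record
    { roman             = λ v v∈V₀ → let (u , u∈A , v~u) = dom v (V₀⁻ A B v∈V₀)
                                     in u , V₂⁺ A B A⊆B u∈A , v~u
    ; outer-independent = λ u v u∈V₀ v∈V₀ u~v → [ V₀⁻ A B u∈V₀ , V₀⁻ A B v∈V₀ ]′ (cover u v u~v)
    ; total             = λ v v∈V₁₂ → let (u , u∈B , v~u) = tot v (V₁∪V₂⁻ A B A⊆B v∈V₁₂)
                                      in u , V₁∪V₂⁺ A B u∈B , v~u
    }

  module _ (noIso : NoIsolatedVertex G) where

    private
      neighbour : Fin n → Fin n
      neighbour v = proj₁ (noIso v _)

      ~neighbour : ∀ v → v ~ neighbour v
      ~neighbour v = proj₂ (proj₂ (noIso v _))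

    total-extension : ∀ {S D} → VertexCover G S → Dominating G D →
      ∃ λ E → ∣ E ∣ ℕ.≤ ∣ D ∣ × NoIsolatedVertexIn G (_∈ (S ∪ E))
    total-extension {S} {D} cover dom = image g D , ∣image∣≤ g D , tot
      where
      g : Fin n → Fin n
      -- A vertex of `D` in `S` contributes one chosen neighbour to the image, and a vertex of `D`
      -- outside `S` contributes itself.
      g d = if does (d ∈? S) then neighbour d else d

      tot : NoIsolatedVertexIn G (_∈ (S ∪ image g D))
      tot v _ with v ∈? S in v∈?S
      -- This case settles the vertices of the image outside `S`: all their neighbours lie in the
      -- cover.
      ... | no v∉S = neighbour v ,
        x∈p∪q⁺ (inj₁ (neighbourhood⊆cover cover v∉S (∈-neighbourhood⁺ (~neighbour v)))) ,
        ~neighbour v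
      ... | yes v∈S with v ∈? D
      ...   | yes v∈D = neighbour v , x∈p∪q⁺ (inj₂ (subst (_∈ image g D) g[v] (∈-image⁺ g v∈D))) ,
                        ~neighbour v
        where
        g[v] : g v ≡ neighbour v
        g[v] rewrite v∈?S = refl
      ...   | no v∉D with dom v v∉D
      -- The dominator `u` of `v` is in the extended set either way: it lies in `S`, or `g` fixes it
      -- and it is in the image.
      ...     | u , u∈D , v~u with u ∈? S in u∈?S
      ...       | yes u∈S = u , x∈p∪q⁺ (inj₁ u∈S) , v~u
      ...       | no  u∉S = u , x∈p∪q⁺ (inj₂ (subst (_∈ image g D) g[u] (∈-image⁺ g u∈D))) , v~u
        where
        g[u] : g u ≡ u
        g[u] rewrite u∈?S = refl

-- The weight bound.

∃-degree≤∣cover∣ : ∀ {n} (G : Graph (suc n)) {S} → VertexCover G S → ∃ λ v → degree G v ℕ.≤ ∣ S ∣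
∃-degree≤∣cover∣ G {S} cover with any? (λ v → ¬? (v ∈? S))
... | yes (v , v∉S) = v , p⊆q⇒∣p∣≤∣q∣ (neighbourhood⊆cover G cover v∉S)
-- Here `S` contains every vertex, hence every neighbourhood, and `zero` serves as well as any other
-- vertex.
... | no  S-full    = zero ,
  p⊆q⇒∣p∣≤∣q∣ {p = neighbourhood G zero} λ {u} _ → decidable-stable (u ∈? S) (λ u∉S → S-full (u , u∉S))

γoitR≤weight : ∀ {n} (G : Graph n) (noIso : NoIsolatedVertex G) {f} →
               OITRDominating G f → γoitR G noIso ℕ.≤ weight f
γoitR≤weight G noIso = IsMinimum.least (proj₂ (oitrDomination-minimum G noIso))

-- With the minima as variables, matching on `refl` turns them into `∣ S ∣`, `∣ D ∣` and
-- `degree G v₀`. The conjunct `d ≤ a` ensures that `suc a ∸ d` is a genuine difference.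
∃-light-OITRDominating : ∀ {n} (G : Graph (suc n)) → NoIsolatedVertex G → ∀ {a c d} →
  IsMinimum (VertexCover G) ∣_∣ a → IsMinimum (Dominating G) ∣_∣ c →
  IsMinimum Unary.U (degree G) d →
  d ℕ.≤ a × ∃ λ f → OITRDominating G f × weight f ℕ.≤ (suc a ∸ d) ℕ.+ (a ℕ.+ c)
∃-light-OITRDominating G noIso
  record { attained = S , cover , refl } record { attained = D , dom , refl }
  record { attained = v₀ , _ , refl ; least = d≤degree }
  with subset-of-size S (suc ∣ S ∣ ∸ degree G v₀)
         (ℕ.∸-monoʳ-≤ (suc ∣ S ∣) (degree>0 G noIso v₀))
     | total-extension G noIso cover dom
... | A , A⊆S , ∣A∣≡ | E , ∣E∣≤ , tot = d≤∣S∣ , labelling A B , f-dominating , bound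
  where
  open Graph G

  B = S ∪ E

  d≤∣S∣ : degree G v₀ ℕ.≤ ∣ S ∣
  d≤∣S∣ = ℕ.≤-trans (d≤degree _) (proj₂ (∃-degree≤∣cover∣ G cover))

  S⊆B : S ⊆ B
  S⊆B = x∈p∪q⁺ ∘ inj₁

  roman : ∀ v → v ∉ B → ∃ λ u → u ∈ A × v ~ u
  roman v v∉B =
    let N⊆S     = neighbourhood⊆cover G cover (v∉B ∘ S⊆B)
        -- The extra 1 in the size of `A` is what pays off here: inside `S`, the neighbourhood of
        -- `v` and `A` together have at least `suc ∣ S ∣` elements, so they meet.
        (u , i) = ∣r∣<∣p∣+∣q∣⇒p∩q≢∅ N⊆S A⊆S (begin
                    suc ∣ S ∣
                      ≤⟨ ℕ.m≤n+m∸n (suc ∣ S ∣) (degree G v₀) ⟩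
                    degree G v₀ ℕ.+ (suc ∣ S ∣ ∸ degree G v₀)
                      ≤⟨ ℕ.+-mono-≤ (d≤degree _) (ℕ.≤-reflexive (sym ∣A∣≡)) ⟩
                    degree G v ℕ.+ ∣ A ∣ ∎)
        (u∈N , u∈A) = x∈p∩q⁻ (neighbourhood G v) A i
    in u , u∈A , ∈-neighbourhood⁻ G u∈N
    where open ℕ.≤-Reasoning

  f-dominating : OITRDominating G (labelling A B)
  f-dominating = labelling-OITRDominating G (S⊆B ∘ A⊆S)
    (λ u v u~v → Sum.map S⊆B S⊆B (cover u v u~v)) roman tot

  bound : weight (labelling A B) ℕ.≤ (suc ∣ S ∣ ∸ degree G v₀) ℕ.+ (∣ S ∣ ℕ.+ ∣ D ∣)
  bound = begin
    weight (labelling A B)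
      ≡⟨ weight-labelling A B ⟩
    ∣ A ∣ ℕ.+ ∣ B ∣
      ≤⟨ ℕ.+-mono-≤ (ℕ.≤-reflexive ∣A∣≡)
           (ℕ.≤-trans (∣p∪q∣≤∣p∣+∣q∣ S E) (ℕ.+-monoʳ-≤ ∣ S ∣ ∣E∣≤)) ⟩
    (suc ∣ S ∣ ∸ degree G v₀) ℕ.+ (∣ S ∣ ℕ.+ ∣ D ∣) ∎
    where open ℕ.≤-Reasoning

theorem2p11 : ∀ {n} (G : Graph (suc n)) → Connected G →
    (noIso : NoIsolatedVertex G) →
    + γoitR G noIso ≤ + 2 * + α G + + γ G - + δ G + + 1
theorem2p11 G _ noIso = let (δ≤α , _ , f-dom , wf≤) = light in begin
  + γoitR G noIso
    ≤⟨ +≤+ (ℕ.≤-trans (γoitR≤weight G noIso f-dom) wf≤) ⟩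
  + (suc (α G) ∸ δ G) + (+ α G + + γ G)
    -- Since `δ G` is at most `α G`, truncated subtraction agrees with integer subtraction.
    ≡⟨ cong (_+ (+ α G + + γ G)) (ℤ.⊖-≥ (ℕ.m≤n⇒m≤1+n δ≤α)) ⟨
  suc (α G) ⊖ δ G + (+ α G + + γ G)
    ≡⟨ cong (_+ (+ α G + + γ G)) (ℤ.m-n≡m⊖n (suc (α G)) (δ G)) ⟨
  + 1 + + α G - + δ G + (+ α G + + γ G)
    ≡⟨ rearrange (+ α G) (+ γ G) (+ δ G) ⟩
  + 2 * + α G + + γ G - + δ G + + 1 ∎
  where
  open ℤ.≤-Reasoning
  light = ∃-light-OITRDominating G noIso (proj₂ (vertexCover-minimum G))
            (proj₂ (domination-minimum G)) (proj₂ (minDegree-minimum G))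

  rearrange : ∀ a c d → + 1 + a - d + (a + c) ≡ + 2 * a + c - d + + 1
  rearrange = solve-∀
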